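{- Let $X$ be a compact geodesic space and let $k\ge 1$ be an integer. Consider the game of Cops and Robber on $X$ with $k$ cops. For every decreasing agility $\tau\in\Sigma^0$ we have $$\underline{\mathrm{Val}}_{\,C}(\tau)=\overline{\mathrm{Val}}_{R}(\tau).$$ Consequently, $\underline{\mathrm{Val}}_{\,C}=\overline{\mathrm{Val}}_{R}$.
   Context: A metric space $(X,d)$ is a geodesic space if for all $x,y\in X$ there is a path from $x$ to $y$ whose length equals $d(x,y)$. The game: $X$ is a compact geodesic space with metric $d$, and $k\ge1$ is the number of cops. A position is a tuple $(r,c)=(r,c_1,\dots,c_k)\in X^{k+1}$ ($r$ is the robber's position, $c_i$ the position of the $i$th cop; cops may share positions). An agility is a function $\tau:\mathbb N=\{1,2,\dots\}\to\mathbb R_+=[0,\infty)$. The set $\Sigma^0$ consists of all agilities with $\tau(n)>0$ for all $n$ and $\sum_{n\ge1}\tau(n)=\infty$. An agility is decreasing if $\tau(n+1)<\tau(n)$ for every $n\ge1$. The robber selects an agility $\tau\in\Sigma^0$ and an initial position $(r^0,c^0)\in X^{k+1}$ (of himself and of all cops). In step $n\ge1$, first the robber moves to a point $r^n$ with $d(r^{n-1},r^n)\le\tau(n)$; knowing $r^n$, each cop $i$ then moves to a point $c_i^n$ with $d(c_i^{n-1},c_i^n)\le\tau(n)$. The game stops with value $0$ if $c_i^n=r^n$ for some $i$; if it never stops, its value is $\inf_{n\ge0}\min_{1\le i\le k}d(r^n,c_i^n)$. Strategies: let $\delta\tau$ be the shift, $\delta\tau(n)=\tau(n+1)$. For given $\tau$,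 a strategy $s$ of the robber consists of the choice of an initial position in $X^{k+1}$ together with a function $(r,c,\tau)\mapsto r'$ with $d(r,r')\le\tau(1)$; a strategy $q$ of the cops is a function $(r',c,\tau)\mapsto c'$ with $d(c_i,c_i')\le\tau(1)$ for all $i$. In step $n$ these functions are applied to the current positions and to the remaining agility $\delta^{n-1}\tau$. Let $v_\tau(s,q)$ be the value of the game with agility $\tau$ played with strategies $s$ and $q$. Define $$\overline{\mathrm{Val}}_{R}(\tau)=\inf_q\sup_s v_\tau(s,q),\quad \overline{\mathrm{Val}}_{R}=\sup_{\tau\in\Sigma^0}\overline{\mathrm{Val}}_{R}(\tau),\quad \underline{\mathrm{Val}}_{\,C}(\tau)=\sup_s\inf_q v_\tau(s,q),\quad \underline{\mathrm{Val}}_{\,C}=\sup_{\tau\in\Sigma^0}\underline{\mathrm{Val}}_{\,C}(\tau).$$ -}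

module Defs where

open import Algebra.Structures using (IsCommutativeRing)
open import Data.Fin using (Fin)
open import Data.List using (List)
open import Data.List.Relation.Unary.Any using (Any)
open import Data.Nat as ℕ using (ℕ; zero; suc)
open import Data.Product using (Σ; ∃; _×_; _,_)
open import Data.Vec using (Vec; lookup)
open import Function.Metric.Structures using (IsGeneralMetric)
open import Level using (0ℓ)
open import Relation.Binary.PropositionalEquality using (_≡_; _≢_)
open import Relation.Binary.Structures using (IsTotalOrder)
open import Relation.Nullary using (¬_)
open import Relation.Unary using (Pred)
import Relation.Binary.Construct.NonStrictToStrict as ToStrict

module Extrema {A : Set} (_≤_ : A → A → Set) where

  UpperBound LowerBound : Pred A 0ℓ → Pred A 0ℓ
  UpperBound P b = ∀ x → P x → x ≤ b
  LowerBound P b = ∀ x → P x → b ≤ x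

  IsSup IsInf IsMin : Pred A 0ℓ → Pred A 0ℓ
  IsSup P s = UpperBound P s × (∀ b → UpperBound P b → s ≤ b)
  IsInf P i = LowerBound P i × (∀ b → LowerBound P b → b ≤ i)
  IsMin P m = P m × LowerBound P m

-- The real numbers, given axiomatically (they are determined up to
-- isomorphism by these axioms).
record CompleteOrderedField : Set₁ where
  infixl 6 _+_
  infixl 7 _*_
  infix  4 _≤_
  field
    ℝ                 : Set
    _+_ _*_           : ℝ → ℝ → ℝ
    -_                : ℝ → ℝ
    0# 1#             : ℝ
    _≤_               : ℝ → ℝ → Set
    isCommutativeRing : IsCommutativeRing _≡_ _+_ _*_ -_ 0# 1#
    0≢1               : 0# ≢ 1#
    inverse           : ∀ x → x ≢ 0# → ∃ λ y → x * y ≡ 1#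
    isTotalOrder      : IsTotalOrder _≡_ _≤_
    +-monoˡ-≤         : ∀ z {x y} → x ≤ y → x + z ≤ y + z
    *-nonNegative     : ∀ {x y} → 0# ≤ x → 0# ≤ y → 0# ≤ x * y

  open Extrema _≤_ public
  open ToStrict _≡_ _≤_ public using (_<_)

  field
    complete : (P : Pred ℝ 0ℓ) → ∃ P → ∃ (UpperBound P) → ∃ (IsSup P)

  -- partialSum f n = f 0 + ⋯ + f (n - 1)
  partialSum : (ℕ → ℝ) → ℕ → ℝ
  partialSum f zero    = 0#
  partialSum f (suc n) = partialSum f n + f n

  record UnitInterval : Set where
    field
      value    : ℝ
      .0≤value : 0# ≤ value
      .value≤1 : value ≤ 1#

  open UnitInterval public

module _ (R : CompleteOrderedField) where
  open CompleteOrderedField R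

  record MetricSpace : Set₁ where
    field
      Carrier  : Set
      d        : Carrier → Carrier → ℝ
      isMetric : IsGeneralMetric _≡_ _≡_ _≤_ 0# _+_ d

module _ {R : CompleteOrderedField} (X : MetricSpace R) where
  open CompleteOrderedField R
  open MetricSpace X

  IsOpen : Pred Carrier 0ℓ → Set
  IsOpen U = ∀ x → U x → ∃ λ ε → 0# < ε × (∀ y → d x y < ε → U y)

  Compact : Set₁
  Compact = (I : Set) (U : I → Pred Carrier 0ℓ) →
            (∀ i → IsOpen (U i)) → (∀ x → ∃ λ i → U i x) →
            ∃ λ (is : List I) → ∀ x → Any (λ i → U i x) is

  -- |s - t| < δ is written as two one-sided inequalities.
  Continuous : (UnitInterval → Carrier) → Set
  Continuous γ = ∀ t ε → 0# < ε → ∃ λ δ → 0# < δ ×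
    (∀ s → value s < value t + δ → value t < value s + δ → d (γ t) (γ s) < ε)

  record Path (x y : Carrier) : Set where
    field
      γ          : UnitInterval → Carrier
      continuous : Continuous γ
      source     : ∀ t → value t ≡ 0# → γ t ≡ x
      target     : ∀ t → value t ≡ 1# → γ t ≡ y

  -- 0 = t 0 ≤ t 1 ≤ ⋯ ≤ t n = 1; the values t i with i > n play no role.
  IsPartition : (ℕ → UnitInterval) → ℕ → Set
  IsPartition t n = value (t 0) ≡ 0# × value (t n) ≡ 1# ×
                    (∀ i → i ℕ.< n → value (t i) ≤ value (t (suc i)))

  IsLength : ∀ {x y} → Path x y → ℝ → Set
  IsLength p = IsSup λ ℓ → ∃ λ t → ∃ λ n → IsPartition t n ×
                 ℓ ≡ partialSum (λ i → d (γ (t i)) (γ (t (suc i)))) n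
    where open Path p

  Geodesic : Set
  Geodesic = ∀ x y → Σ (Path x y) λ p → IsLength p (d x y)

module Agilities (R : CompleteOrderedField) where
  open CompleteOrderedField R

  -- Agilities are indexed from 0 here, so that τ n is the bound on the moves
  -- in step n + 1.
  IsAgility : Pred (ℕ → ℝ) 0ℓ
  IsAgility τ = ∀ n → 0# ≤ τ n

  Σ⁰ : Pred (ℕ → ℝ) 0ℓ
  Σ⁰ τ = (∀ n → 0# < τ n) × (∀ M → ∃ λ n → M ≤ partialSum τ n)

  Decreasing : Pred (ℕ → ℝ) 0ℓ
  Decreasing τ = ∀ n → τ (suc n) < τ n

  shift : (ℕ → ℝ) → (ℕ → ℝ)
  shift τ n = τ (suc n)

  shift^ : ℕ → (ℕ → ℝ) → (ℕ → ℝ)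
  shift^ zero    τ = τ
  shift^ (suc n) τ = shift (shift^ n τ)

module Game {R : CompleteOrderedField} (X : MetricSpace R) (k : ℕ) where
  open CompleteOrderedField R
  open MetricSpace X
  open Agilities R

  Position : Set
  Position = Carrier × Vec Carrier k

  record RobberStrategy : Set where
    field
      initial : Position
      move    : Carrier → Vec Carrier k → (ℕ → ℝ) → Carrier
      legal   : ∀ r c τ → IsAgility τ → d r (move r c τ) ≤ τ 0

  -- The first argument of move is the position of the robber after his move.
  record CopsStrategy : Set where
    field
      move  : Carrier → Vec Carrier k → (ℕ → ℝ) → Vec Carrier k
      legal : ∀ r′ c τ → IsAgility τ → ∀ i →
              d (lookup c i) (lookup (move r′ c τ) i) ≤ τ 0

  round : RobberStrategy → CopsStrategy → (ℕ → ℝ) → Position → Position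
  round s q σ (r , c) = r′ , CopsStrategy.move q r′ c σ
    where
    r′ : Carrier
    r′ = RobberStrategy.move s r c σ

  -- The position after n steps. A play that has stopped is continued
  -- formally; IsValue does not look at the continuation.
  play : (ℕ → ℝ) → RobberStrategy → CopsStrategy → ℕ → Position
  play τ s q zero    = RobberStrategy.initial s
  play τ s q (suc n) = round s q (shift^ n τ) (play τ s q n)

  Captured : Position → Set
  Captured (r , c) = ∃ λ (i : Fin k) → lookup c i ≡ r

  IsMinDistance : Position → ℝ → Set
  IsMinDistance (r , c) = IsMin λ x → ∃ λ (i : Fin k) → x ≡ d r (lookup c i)

  Stops : (ℕ → ℝ) → RobberStrategy → CopsStrategy → Set
  Stops τ s q = ∃ λ n → Captured (play τ s q n)

  -- Values, suprema and infima are given as relations "v is the value":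
  -- each of them has at most one solution v.

  IsValue : (ℕ → ℝ) → RobberStrategy → CopsStrategy → ℝ → Set
  IsValue τ s q v =
    (Stops τ s q → v ≡ 0#) ×
    (¬ Stops τ s q → IsInf (λ x → ∃ λ n → IsMinDistance (play τ s q n) x) v)

  -- inf_q sup_s v_τ(s,q)
  IsValR[_] : (ℕ → ℝ) → ℝ → Set
  IsValR[ τ ] = IsInf λ x → ∃ λ q → IsSup (λ y → ∃ λ s → IsValue τ s q y) x

  -- sup_s inf_q v_τ(s,q)
  IsValC[_] : (ℕ → ℝ) → ℝ → Set
  IsValC[ τ ] = IsSup λ x → ∃ λ s → IsInf (λ y → ∃ λ q → IsValue τ s q y) x

  IsValR : ℝ → Set
  IsValR = IsSup λ x → ∃ λ τ → Σ⁰ τ × IsValR[ τ ] x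

  IsValC : ℝ → Set
  IsValC = IsSup λ x → ∃ λ τ → Σ⁰ τ × IsValC[ τ ] x

{-# OPTIONS --safe #-}

-- Fix a threshold a. "Some cop gets closer than a" is a reachability objective
-- of the cops in a perfect-information game whose states consist of a position
-- and the remaining agility, so at every state one side wins. The robber wins
-- positionally by never entering a state that is winning for the cops; the cops
-- win positionally by always moving to a state of least ordinal rank. Thus every a
-- satisfies a ≤ sup inf or inf sup ≤ a, and density of the reals gives equality of
-- the two values, for every agility in Σ⁰. Compactness enters only in bounding
-- the distances, so that the suprema exist.

module Submission where

open import Defs
open import Algebra.Bundles using (CommutativeRing)
open import Axiom.ExcludedMiddle using (ExcludedMiddle)
open import Data.Fin using (Fin; zero; suc)
open import Data.List using (List; []; _∷_)
open import Data.List.Relation.Unary.Any using (Any; here; there)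
import Data.List.Relation.Unary.Any as Any
open import Data.Nat using (ℕ; zero; suc)
open import Data.Product using (∃; _×_; _,_; proj₁; proj₂)
open import Data.Sum using (_⊎_; inj₁; inj₂)
open import Data.Vec using (Vec; lookup; replicate)
open import Function.Metric.Structures using (IsGeneralMetric)
open import Induction.WellFounded using (Acc; acc; WellFounded)
open import Level using (0ℓ)
open import Relation.Binary.PropositionalEquality using (_≡_; _≢_; refl; sym; trans; cong; cong₂; subst; subst₂; module ≡-Reasoning)
open import Relation.Binary.Structures using (IsTotalOrder)
open import Relation.Nullary using (¬_; Dec; yes; no; contradiction)
open import Relation.Nullary.Decidable using (decidable-stable; map′)
open import Relation.Unary using (Pred)
import Algebra.Properties.Ring as RingProperties
import Relation.Binary.Construct.NonStrictToStrict as ToStrict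

-- Brouwer trees as ordinal ranks

module Ranks (em : ExcludedMiddle 0ℓ) (I : Set) where

  -- The branching type will be the set of points of the space, so that a single node can hold one
  -- child for every robber move.
  data Rank : Set where
    leaf : Rank
    node : (I → Rank) → Rank

  infix 4 _≤_ _<_

  -- Trees are compared by height: `node f` stands for the least ordinal above all `f i`, so
  -- distinct trees may lie below each other.
  mutual
    data _≤_ : Rank → Rank → Set where
      leaf≤ : ∀ {t} → leaf ≤ t
      node≤ : ∀ {f t} → (∀ i → f i < t) → node f ≤ t

    data _<_ : Rank → Rank → Set where
      below : ∀ {s f} i → s ≤ f i → s < node f

  mutual
    ≤-trans : ∀ {s t u} → s ≤ t → t ≤ u → s ≤ u
    ≤-trans leaf≤       t≤u = leaf≤
    ≤-trans (node≤ f<t) t≤u = node≤ λ i → <-≤-trans (f<t i) t≤u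

    <-≤-trans : ∀ {s t u} → s < t → t ≤ u → s < u
    <-≤-trans (below i s≤fi) (node≤ f<u) with f<u i
    ... | below j fi≤gj = below j (≤-trans s≤fi fi≤gj)

  -- Classical linearity. If `f i < s` failed, the recursive call with the roles swapped would give
  -- `s ≤ f i`, hence `s < node f`.
  ≮⇒≥ : ∀ s t → ¬ s < t → t ≤ s
  ≮⇒≥ s leaf     s≮t = leaf≤
  ≮⇒≥ s (node f) s≮t = node≤ λ i →
    decidable-stable em λ fi≮s → s≮t (below i (≮⇒≥ (f i) s fi≮s))

  -- A predecessor of `s` need not be a subtree of `t`, only bounded by one. Proving accessibility
  -- for everything below `t` makes the recursion structural in `t`.
  ≤-acc : ∀ t {s} → s ≤ t → Acc _<_ s
  ≤-acc t        leaf≤       = acc λ ()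
  ≤-acc leaf     (node≤ g<t) = acc λ { (below i _) → contradiction (g<t i) λ () }
  ≤-acc (node f) (node≤ g<t) = acc λ { (below i u≤gi) → under u≤gi (g<t i) }
    where
    under : ∀ {u v} → u ≤ v → v < node f → Acc _<_ u
    under u≤v (below j v≤fj) = ≤-acc (f j) (≤-trans u≤v v≤fj)

  ≤-refl : ∀ t → t ≤ t
  ≤-refl leaf     = leaf≤
  ≤-refl (node f) = node≤ λ i → below i (≤-refl (f i))

  <-wellFounded : WellFounded _<_
  <-wellFounded t = ≤-acc t (≤-refl t)

  Least : Pred Rank 0ℓ → Set
  Least P = ∃ λ m → P m × (∀ t → P t → m ≤ t)

  least : (P : Pred Rank 0ℓ) → ∃ P → Least P
  least P (t , Pt) = go t Pt (<-wellFounded t)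
    where
    go : ∀ t → P t → Acc _<_ t → Least P
    go t Pt (acc rec) with em {∃ λ s → P s × s < t}
    ... | yes (s , Ps , s<t) = go s Ps (rec s<t)
    ... | no  ¬smaller       = t , Pt , λ s Ps → ≮⇒≥ s t λ s<t → ¬smaller (s , Ps , s<t)

-- Real numbers

module Reals (em : ExcludedMiddle 0ℓ) (R : CompleteOrderedField) where

  open CompleteOrderedField R
  open IsTotalOrder isTotalOrder public
    using (total; antisym) renaming (refl to ≤-refl; reflexive to ≤-reflexive; trans to ≤-trans)

  commutativeRing : CommutativeRing 0ℓ 0ℓ
  commutativeRing = record { isCommutativeRing = isCommutativeRing }

  open CommutativeRing commutativeRing
    using (ring; +-assoc; +-comm; +-identityˡ; +-identityʳ; -‿inverseˡ; -‿inverseʳ; *-identityˡ; distribʳ)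
  open RingProperties ring using (-‿distribˡ-*; -‿involutive; +-cancelˡ)

  <⇒≱ : ∀ {x y} → x < y → ¬ y ≤ x
  <⇒≱ = ToStrict.<⇒≱ _≡_ _≤_ antisym

  ≰⇒> : ∀ {x y} → ¬ x ≤ y → y < x
  ≰⇒> = ToStrict.≰⇒> _≡_ _≤_ sym ≤-reflexive total

  ≮⇒≥ : ∀ {x y} → ¬ x < y → y ≤ x
  ≮⇒≥ = ToStrict.≮⇒≥ _≡_ _≤_ sym (λ _ _ → em) ≤-reflexive total

  +-monoʳ-≤ : ∀ z {x y} → x ≤ y → z + x ≤ z + y
  +-monoʳ-≤ z x≤y = subst₂ _≤_ (+-comm _ z) (+-comm _ z) (+-monoˡ-≤ z x≤y)

  +-mono-≤ : ∀ {x y z w} → x ≤ y → z ≤ w → x + z ≤ y + w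
  +-mono-≤ x≤y z≤w = ≤-trans (+-monoˡ-≤ _ x≤y) (+-monoʳ-≤ _ z≤w)

  x+y-y≡x : ∀ x y → x + y + - y ≡ x
  x+y-y≡x x y = trans (+-assoc x y (- y)) (trans (cong (x +_) (-‿inverseʳ y)) (+-identityʳ x))

  x-y+y≡x : ∀ x y → x + - y + y ≡ x
  x-y+y≡x x y = trans (+-assoc x (- y) y) (trans (cong (x +_) (-‿inverseˡ y)) (+-identityʳ x))

  +-cancelʳ-≤ : ∀ z {x y} → x + z ≤ y + z → x ≤ y
  +-cancelʳ-≤ z x+z≤y+z = subst₂ _≤_ (x+y-y≡x _ z) (x+y-y≡x _ z) (+-monoˡ-≤ (- z) x+z≤y+z)

  +-cancelˡ-≤ : ∀ z {x y} → z + x ≤ z + y → x ≤ y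
  +-cancelˡ-≤ z z+x≤z+y = +-cancelʳ-≤ z (subst₂ _≤_ (+-comm z _) (+-comm z _) z+x≤z+y)

  0≤1 : 0# ≤ 1#
  0≤1 with total 0# 1#
  ... | inj₁ 0≤1 = 0≤1
  ... | inj₂ 1≤0 = subst (0# ≤_) -1*-1≡1 (*-nonNegative 0≤-1 0≤-1)
    where
    0≤-1 : 0# ≤ - 1#
    0≤-1 = subst₂ _≤_ (-‿inverseʳ 1#) (+-identityˡ (- 1#)) (+-monoˡ-≤ (- 1#) 1≤0)

    -1*-1≡1 : - 1# * - 1# ≡ 1#
    -1*-1≡1 = trans (sym (-‿distribˡ-* 1# (- 1#))) (trans (cong -_ (*-identityˡ (- 1#))) (-‿involutive 1#))

  x<x+1 : ∀ x → x < x + 1#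
  x<x+1 x = subst (_≤ x + 1#) (+-identityʳ x) (+-monoʳ-≤ x 0≤1)
          , λ x≡x+1 → 0≢1 (+-cancelˡ x 0# 1# (trans (+-identityʳ x) x≡x+1))

  half : ∀ x → ∃ λ y → y + y ≡ x
  half x with inverse (1# + 1#) 2≢0
    where
    2≢0 : 1# + 1# ≢ 0#
    2≢0 2≡0 = <⇒≱ (x<x+1 1#) (subst (_≤ 1#) (sym 2≡0) 0≤1)
  ... | ½ , 2*½≡1 = ½ * x , (begin
    ½ * x + ½ * x                ≡⟨ distribʳ x ½ ½ ⟨
    (½ + ½) * x                  ≡⟨ cong (_* x) (cong₂ _+_ (*-identityˡ ½) (*-identityˡ ½)) ⟨
    (1# * ½ + 1# * ½) * x        ≡⟨ cong (_* x) (distribʳ ½ 1# 1#) ⟨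
    (1# + 1#) * ½ * x            ≡⟨ cong (_* x) 2*½≡1 ⟩
    1# * x                       ≡⟨ *-identityˡ x ⟩
    x                            ∎)
    where open ≡-Reasoning

  dense : ∀ {x y} → x < y → ∃ λ z → x < z × z < y
  dense {x} {y} x<y with half (x + y)
  ... | z , z+z≡x+y = z , ≰⇒> z≰x , ≰⇒> y≰z
    where
    z≰x : ¬ z ≤ x
    z≰x z≤x = <⇒≱ x<y (+-cancelˡ-≤ x (subst (_≤ x + x) z+z≡x+y (+-mono-≤ z≤x z≤x)))

    y≰z : ¬ y ≤ z
    y≰z y≤z = <⇒≱ x<y (+-cancelʳ-≤ y (subst (y + y ≤_) z+z≡x+y (+-mono-≤ y≤z y≤z)))

  -- The infimum is the supremum of the lower bounds, which any element of `P` bounds from above.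
  infimum : (P : Pred ℝ 0ℓ) → ∃ P → ∃ (LowerBound P) → ∃ (IsInf P)
  infimum P (x , Px) bounded with complete (LowerBound P) bounded (x , λ b b≤P → b≤P x Px)
  ... | i , ub , lub = i , (λ y Py → lub y λ b b≤P → b≤P y Py) , ub

  IsSup-cong : ∀ {P Q : Pred ℝ 0ℓ} → (∀ {x} → P x → Q x) → (∀ {x} → Q x → P x) →
               ∀ {s} → IsSup P s → IsSup Q s
  IsSup-cong P⇒Q Q⇒P (ub , lub) = (λ x Qx → ub x (Q⇒P Qx)) , λ b Q≤b → lub b λ x Px → Q≤b x (P⇒Q Px)

  IsSup-unique : ∀ {P s t} → IsSup P s → IsSup P t → s ≡ t
  IsSup-unique (ubₛ , lubₛ) (ubₜ , lubₜ) = antisym (lubₛ _ ubₜ) (lubₜ _ ubₛ)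

  IsInf-unique : ∀ {P s t} → IsInf P s → IsInf P t → s ≡ t
  IsInf-unique (lbₛ , glbₛ) (lbₜ , glbₜ) = antisym (glbₜ _ lbₛ) (glbₛ _ lbₜ)

  -- The Archimedean property: adding 1 to a partial sum gives the next one, so if `s` were the
  -- supremum of the sums, `s - 1` would be an upper bound too.
  sum-of-ones-unbounded : ∀ M → ∃ λ n → M ≤ partialSum (λ _ → 1#) n
  sum-of-ones-unbounded M = decidable-stable em λ bounded →
    let S           = partialSum (λ _ → 1#)
        s , ub , lub = complete (λ x → ∃ λ n → x ≡ S n) (0# , 0 , refl)
                       (M , λ { _ (n , refl) → proj₁ (≰⇒> λ M≤Sn → bounded (n , M≤Sn)) })
        S≤s-1 : UpperBound (λ x → ∃ λ n → x ≡ S n) (s + - 1#)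
        S≤s-1 = λ { _ (n , refl) → +-cancelʳ-≤ 1# (subst (S n + 1# ≤_) (sym (x-y+y≡x s 1#)) (ub _ (suc n , refl))) }
    in <⇒≱ (x<x+1 s) (subst (s + 1# ≤_) (x-y+y≡x s 1#) (+-monoˡ-≤ 1# (lub _ S≤s-1)))

  minimum : ∀ {n} (f : Fin (suc n) → ℝ) → ∃ λ i → ∀ j → f i ≤ f j
  minimum {zero}  f = zero , λ { zero → ≤-refl }
  minimum {suc n} f with minimum (λ j → f (suc j))
  ... | i , fi≤ with total (f zero) (f (suc i))
  ...   | inj₁ f0≤fi = zero  , λ { zero → ≤-refl ; (suc j) → ≤-trans f0≤fi (fi≤ j) }
  ...   | inj₂ fi≤f0 = suc i , λ { zero → fi≤f0  ; (suc j) → fi≤ j }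

  list-bound : (ys : List ℝ) → ∃ λ b → ∀ {x} → Any (x ≤_) ys → x ≤ b
  list-bound []       = 0# , λ ()
  list-bound (y ∷ ys) with list-bound ys
  ... | b , ≤b with total y b
  ...   | inj₁ y≤b = b , λ { (here x≤y) → ≤-trans x≤y y≤b ; (there x≤ys) → ≤b x≤ys }
  ...   | inj₂ b≤y = y , λ { (here x≤y) → x≤y ; (there x≤ys) → ≤-trans (≤b x≤ys) b≤y }

  -- The payoff is a relation because the value of a play is only given as one.
  module Minimax {S Q : Set} (Payoff : S → Q → Pred ℝ 0ℓ) where

    GuaranteesAtLeast : S → Pred ℝ 0ℓ
    GuaranteesAtLeast s a = ∀ q → LowerBound (Payoff s q) a

    GuaranteesAtMost : Q → Pred ℝ 0ℓ
    GuaranteesAtMost q a = ∀ s → UpperBound (Payoff s q) a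

    IsSupInf IsInfSup : Pred ℝ 0ℓ
    IsSupInf = IsSup λ x → ∃ λ s → IsInf (λ y → ∃ λ q → Payoff s q y) x
    IsInfSup = IsInf λ x → ∃ λ q → IsSup (λ y → ∃ λ s → Payoff s q y) x

    -- The bounds `lo` and `hi` let completeness produce all infima and suprema. The bound `v ≤ hi`
    -- is returned for the later supremum over agilities, which needs a bound uniform in them.
    minimax : S → Q → (∀ s q → ∃ (Payoff s q)) →
              ∀ {lo hi} → (∀ s → GuaranteesAtLeast s lo) → (∀ q → GuaranteesAtMost q hi) →
              (∀ a → ∃ (λ s → GuaranteesAtLeast s a) ⊎ ∃ (λ q → GuaranteesAtMost q a)) →
              ∃ λ v → v ≤ hi × IsSupInf v × IsInfSup v
    minimax s₀ q₀ payoff {lo} {hi} lo≤ ≤hi determined =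
      let inf₀ , isInf₀ = inf s₀
          v , ub , lub  = complete _ (inf₀ , s₀ , isInf₀) (hi , inf≤hi)
      in  v , lub hi inf≤hi , (ub , lub) , lower v lub , greatest v ub
      where
      inf : ∀ s → ∃ (IsInf λ y → ∃ λ q → Payoff s q y)
      inf s = infimum _ (_ , q₀ , proj₂ (payoff s q₀)) (lo , λ { y (q , p) → lo≤ s q y p })

      sup : ∀ q → ∃ (IsSup λ y → ∃ λ s → Payoff s q y)
      sup q = complete _ (_ , s₀ , proj₂ (payoff s₀ q)) (hi , λ { y (s , p) → ≤hi q s y p })

      Infs Sups : Pred ℝ 0ℓ
      Infs x = ∃ λ s → IsInf (λ y → ∃ λ q → Payoff s q y) x
      Sups x = ∃ λ q → IsSup (λ y → ∃ λ s → Payoff s q y) x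

      inf≤hi : UpperBound Infs hi
      inf≤hi x (s , lb , _) = let y , p = payoff s q₀ in ≤-trans (lb y (q₀ , p)) (≤hi q₀ s y p)

      -- Weak duality: the payoff of `s` against `q` lies between the infimum for `s` and the
      -- supremum for `q`.
      lower : ∀ v → (∀ b → UpperBound Infs b → v ≤ b) → LowerBound Sups v
      lower v lub x (q , x-ub , _) = lub x λ { y (s , y-lb , _) →
        let z , p = payoff s q in ≤-trans (y-lb z (q , p)) (x-ub z (s , p)) }

      greatest : ∀ v → UpperBound Infs v → ∀ b → LowerBound Sups b → b ≤ v
      greatest v ub b b≤sups = ≮⇒≥ λ v<b → absurd (dense v<b)
        where
        absurd : ¬ (∃ λ a → v < a × a < b)
        -- At a threshold strictly inside the gap, a guarantee of the robber would lift `v` to `a`,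
        -- and one of the cops would push `b` down to `a`.
        absurd (a , v<a , a<b) with determined a
        ... | inj₁ (s , a≤) = let x , lb , glb = inf s in
          <⇒≱ v<a (≤-trans (glb a λ { y (q , p) → a≤ q y p }) (ub x (s , lb , glb)))
        ... | inj₂ (q , ≤a) = let x , x-ub , x-lub = sup q in
          <⇒≱ a<b (≤-trans (b≤sups x (q , x-ub , x-lub)) (x-lub a λ { y (s , p) → ≤a s y p }))

-- Boundedness of compact metric spaces

module Distances (em : ExcludedMiddle 0ℓ) {R : CompleteOrderedField} (X : MetricSpace R) where

  open CompleteOrderedField R
  open MetricSpace X
  open Reals em R
  open IsGeneralMetric isMetric using (triangle) renaming (sym to d-sym)

  ball-open : ∀ x₀ ρ → IsOpen X (λ x → d x₀ x < ρ)
  ball-open x₀ ρ x (dx≤ρ , dx≢ρ) = ρ + - d x₀ x , ε>0 , λ y dxy<ε →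
    ≰⇒> λ ρ≤dy → <⇒≱ dxy<ε (+-cancelʳ-≤ (d x₀ x) (subst₂ _≤_ (sym (x-y+y≡x ρ (d x₀ x))) (+-comm _ _)
      (≤-trans ρ≤dy (triangle x₀ x y))))
    where
    open CommutativeRing commutativeRing using (+-comm; +-identityˡ)

    ε>0 : 0# < ρ + - d x₀ x
    ε>0 = ≰⇒> λ ε≤0 → <⇒≱ (dx≤ρ , dx≢ρ)
      (subst₂ _≤_ (x-y+y≡x ρ (d x₀ x)) (+-identityˡ _) (+-monoˡ-≤ (d x₀ x) ε≤0))

  -- The balls around `x₀` of all radii cover the space. A bound `b` on the radii of a finite
  -- subcover bounds every distance to `x₀`, so `b + b` bounds all distances.
  compact⇒bounded : Carrier → Compact X → ∃ λ D → ∀ x y → d x y ≤ D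
  compact⇒bounded x₀ compact
    with compact ℝ (λ ρ x → d x₀ x < ρ) (ball-open x₀) (λ x → d x₀ x + 1# , x<x+1 (d x₀ x))
  ... | ρs , covers with list-bound ρs
  ...   | b , ≤b = b + b , λ x y → ≤-trans (triangle x x₀ y)
          (+-mono-≤ (subst (_≤ b) (d-sym x₀ x) (dist≤b x)) (dist≤b y))
    where
    dist≤b : ∀ x → d x₀ x ≤ b
    dist≤b x = ≤b (Any.map proj₁ (covers x))

-- Positional determinacy at a threshold

module Determinacy (em : ExcludedMiddle 0ℓ) {R : CompleteOrderedField} (X : MetricSpace R) (k : ℕ) where

  open CompleteOrderedField R
  open MetricSpace X
  open Agilities R
  open Game X k
  open IsGeneralMetric isMetric using (≈⇒0)
  open Ranks em Carrier using (Rank; leaf; node; below; Least; least; <-wellFounded)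
    renaming (_≤_ to _≤ᵣ_; _<_ to _<ᵣ_)

  stay-legal : ∀ {x σ} → IsAgility σ → d x x ≤ σ 0
  stay-legal {σ = σ} σ≥0 = subst (_≤ σ 0) (sym (≈⇒0 refl)) (σ≥0 0)

  Reachable : Vec Carrier k → (ℕ → ℝ) → Vec Carrier k → Set
  Reachable c σ c′ = ∀ i → d (lookup c i) (lookup c′ i) ≤ σ 0

  shift^-agility : ∀ {τ} → IsAgility τ → ∀ n → IsAgility (shift^ n τ)
  shift^-agility τ≥0 zero    m = τ≥0 m
  shift^-agility τ≥0 (suc n) m = shift^-agility τ≥0 n (suc m)

  module Threshold (a : ℝ) where

    -- Strictness splits the outcomes exactly: never near keeps all distances at least `a`, and one
    -- near position bounds the value by `a`.
    Near : Pred Position 0ℓ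
    Near (r , c) = ∃ λ i → d r (lookup c i) < a

    -- The rank bounds the rounds left until a near position. The child `f x` used against `r′` may
    -- be any child, so `x` is only an index and need not equal `r′`.
    mutual
      Forced : Rank → Position → (ℕ → ℝ) → Set
      Forced leaf     p       σ = Near p
      Forced (node f) (r , c) σ = ∀ r′ → d r r′ ≤ σ 0 → ∃ λ x → Answer r′ c σ (f x)

      Answer : Carrier → Vec Carrier k → (ℕ → ℝ) → Rank → Set
      Answer r′ c σ t = ∃ λ c′ → Reachable c σ c′ × Forced t (r′ , c′) (shift σ)

    CopsWin : Position → (ℕ → ℝ) → Set
    CopsWin p σ = ∃ λ t → Forced t p σ

    best : ∀ r′ c σ → Dec (Least (Answer r′ c σ))
    best r′ c σ = map′ (least _) (λ { (t , ans , _) → t , ans }) em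

    cops : CopsStrategy
    cops = record { move = move ; legal = legal }
      where
      move : Carrier → Vec Carrier k → (ℕ → ℝ) → Vec Carrier k
      move r′ c σ with best r′ c σ
      ... | yes (_ , (c′ , _) , _) = c′
      -- Default when no winning answer exists; standing still is legal for every agility.
      ... | no  _                  = c

      legal : ∀ r′ c σ → IsAgility σ → Reachable c σ (move r′ c σ)
      legal r′ c σ σ≥0 with best r′ c σ
      ... | yes (_ , (_ , reach , _) , _) = reach
      ... | no  _                         = λ i → stay-legal σ≥0

    -- The strategy cannot see the rank of the winning proof at hand, but its own choice has least
    -- rank among all answers, so following it never loses progress.
    cops-answer : ∀ {r′ c σ t} → Answer r′ c σ t →
                  ∃ λ m → m ≤ᵣ t × Forced m (r′ , CopsStrategy.move cops r′ c σ) (shift σ)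
    cops-answer {r′} {c} {σ} {t} ans with best r′ c σ
    ... | yes (m , (_ , _ , forced) , m-least) = m , m-least t ans , forced
    ... | no  ¬best                            = contradiction (least _ (t , ans)) ¬best

    -- Each round replaces `node f` by a rank at most some `f x`, hence strictly smaller;
    -- well-foundedness forces a leaf, which is a near position.
    cops-reach : ∀ {τ} → IsAgility τ → ∀ s → CopsWin (RobberStrategy.initial s) τ →
                 ∃ λ n → Near (play τ s cops n)
    cops-reach {τ} τ≥0 s (t₀ , forced₀) = go 0 t₀ (<-wellFounded t₀) forced₀
      where
      go : ∀ n t → Acc _<ᵣ_ t → Forced t (play τ s cops n) (shift^ n τ) →
           ∃ λ n → Near (play τ s cops n)
      go n leaf     _         near   = n , near
      go n (node f) (acc rec) forced =
        let r , c            = play τ s cops n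
            x , ans          = forced _ (RobberStrategy.legal s r c (shift^ n τ) (shift^-agility τ≥0 n))
            m , m≤ , forced′ = cops-answer ans
        in  go (suc n) m (rec (below x m≤)) forced′

    Escape : Carrier → Vec Carrier k → (ℕ → ℝ) → Pred Carrier 0ℓ
    Escape r c σ r′ = d r r′ ≤ σ 0 × (∀ c′ → Reachable c σ c′ → ¬ CopsWin (r′ , c′) (shift σ))

    -- Otherwise every legal robber move has an answer of some rank, and collecting these ranks as
    -- the children of one node makes the present state a win for the cops.
    escape : ∀ {r c σ} → ¬ CopsWin (r , c) σ → ∃ (Escape r c σ)
    escape {r} {c} {σ} ¬win = decidable-stable em λ ¬escape →
      ¬win (node rank , λ r′ legal → r′ , rank-answer r′ (decidable-stable em λ ¬ans →
        ¬escape (r′ , legal , λ { c′ reach (t , forced) → ¬ans (t , c′ , reach , forced) })))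
      where
      rank : Carrier → Rank
      rank r′ with em {∃ (Answer r′ c σ)}
      ... | yes (t , _) = t
      -- A filler that makes `rank` total; under the assumption being refuted, every legal `r′` has
      -- an answer.
      ... | no  _       = leaf

      rank-answer : ∀ r′ → ∃ (Answer r′ c σ) → Answer r′ c σ (rank r′)
      rank-answer r′ exists with em {∃ (Answer r′ c σ)}
      ... | yes (_ , ans) = ans
      ... | no  ¬exists   = contradiction exists ¬exists

    robber : Position → RobberStrategy
    robber p = record { initial = p ; move = move ; legal = legal }
      where
      move : Carrier → Vec Carrier k → (ℕ → ℝ) → Carrier
      move r c σ with em {∃ (Escape r c σ)}
      ... | yes (r′ , _) = r′
      ... | no  _        = r

      legal : ∀ r c σ → IsAgility σ → d r (move r c σ) ≤ σ 0
      legal r c σ σ≥0 with em {∃ (Escape r c σ)}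
      ... | yes (_ , legal , _) = legal
      ... | no  _               = stay-legal σ≥0

    robber-escapes : ∀ p {r c σ} → ∃ (Escape r c σ) → Escape r c σ (RobberStrategy.move (robber p) r c σ)
    robber-escapes p {r} {c} {σ} exists with em {∃ (Escape r c σ)}
    ... | yes (_ , esc) = esc
    ... | no  ¬exists   = contradiction exists ¬exists

    -- The invariant is that the current state is not won by the cops; a near position would be won
    -- with rank `leaf`.
    robber-safe : ∀ {τ p} → IsAgility τ → ¬ CopsWin p τ → ∀ q n → ¬ Near (play τ (robber p) q n)
    robber-safe {τ} {p} τ≥0 ¬win q n near = safe n (leaf , near)
      where
      safe : ∀ n → ¬ CopsWin (play τ (robber p) q n) (shift^ n τ)
      safe zero    = ¬win
      safe (suc n) =
        let r , c = play τ (robber p) q n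
        in  proj₂ (robber-escapes p (escape (safe n))) _
              (CopsStrategy.legal q _ c (shift^ n τ) (shift^-agility τ≥0 n))

    -- The robber chooses the initial position: one position outside `CopsWin` suffices for him,
    -- while the cops must win from all of them.
    determined : ∀ {τ} → IsAgility τ →
      (∃ λ s → ∀ q n → ¬ Near (play τ s q n)) ⊎
      (∃ λ q → ∀ s → ∃ λ n → Near (play τ s q n))
    determined {τ} τ≥0 with em {∃ λ p → ¬ CopsWin p τ}
    ... | yes (p , ¬win) = inj₁ (robber p , robber-safe τ≥0 ¬win)
    ... | no  ¬safe      = inj₂ (cops , λ s →
            cops-reach τ≥0 s (decidable-stable em λ ¬win → ¬safe (_ , ¬win)))

-- Existence and equality of the game values

module Values (em : ExcludedMiddle 0ℓ) {R : CompleteOrderedField} (X : MetricSpace R)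
              (x₀ : MetricSpace.Carrier X) (compact : Compact X) (k : ℕ) where

  open CompleteOrderedField R
  open MetricSpace X
  open Agilities R
  open Game X (suc k)
  open Reals em R
  open IsGeneralMetric isMetric using (≈⇒0; nonNegative)
  open Determinacy em X (suc k)

  PlayDistance : (ℕ → ℝ) → RobberStrategy → CopsStrategy → Pred ℝ 0ℓ
  PlayDistance τ s q x = ∃ λ n → IsMinDistance (play τ s q n) x

  minDistance : ∀ p → ∃ (IsMinDistance p)
  minDistance (r , c) with minimum (λ i → d r (lookup c i))
  ... | i , least = d r (lookup c i) , (i , refl) , λ { _ (j , refl) → least j }

  distances≥0 : ∀ {τ s q} → LowerBound (PlayDistance τ s q) 0#
  distances≥0 _ (_ , (_ , refl) , _) = nonNegative

  -- The value of a stopped play is also the infimum over its formal continuation, since capture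
  -- contributes a distance 0 and no distance is negative. Both kinds of play can then be treated
  -- alike.
  isInf-distances : ∀ {τ s q v} → IsValue τ s q v → IsInf (PlayDistance τ s q) v
  isInf-distances {τ} {s} {q} (stopped , unstopped) with em {Stops τ s q}
  ... | no  ¬stops                 = unstopped ¬stops
  ... | yes stops@(n , i , caught) with stopped stops
  ...   | refl = distances≥0 , λ b b≤ →
          let x , isMin = minDistance (play τ s q n)
          in  ≤-trans (b≤ x (n , isMin))
                (subst (x ≤_) (≈⇒0 (sym caught)) (proj₂ isMin _ (i , refl)))

  gameValue : ∀ τ s q → ∃ (IsValue τ s q)
  gameValue τ s q with em {Stops τ s q}
  ... | yes stops  = 0# , (λ _ → refl) , contradiction stops
  ... | no  ¬stops =
    let x , isMin = minDistance (play τ s q 0)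
        v , isInf = infimum (PlayDistance τ s q) (x , 0 , isMin) (0# , distances≥0)
    in  v , (λ stops → contradiction stops ¬stops) , λ _ → isInf

  diameter : ∃ λ D → ∀ x y → d x y ≤ D
  diameter = Distances.compact⇒bounded em X x₀ compact

  value≥0 : ∀ {τ s q} → LowerBound (IsValue τ s q) 0#
  value≥0 v isValue = proj₂ (isInf-distances isValue) 0# distances≥0

  value≤distance : ∀ {τ s q v} → IsValue τ s q v → ∀ n i →
                   let r , c = play τ s q n in v ≤ d r (lookup c i)
  value≤distance {τ} {s} {q} isValue n i =
    let x , isMin = minDistance (play τ s q n)
    in  ≤-trans (proj₁ (isInf-distances isValue) x (n , isMin)) (proj₂ isMin _ (i , refl))

  ≤value : ∀ {τ s q a} → (∀ n → ¬ Threshold.Near a (play τ s q n)) → LowerBound (IsValue τ s q) a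
  ≤value far v isValue = proj₂ (isInf-distances isValue) _ λ { _ (n , (i , refl) , _) →
    ≮⇒≥ λ near → far n (i , near) }

  -- Together with `wait`, this shows that the strategy sets are inhabited, as `minimax` requires.
  stay : RobberStrategy
  stay = record { initial = x₀ , replicate (suc k) x₀ ; move = λ r _ _ → r ; legal = λ _ _ _ → stay-legal }

  wait : CopsStrategy
  wait = record { move = λ _ c _ → c ; legal = λ _ _ _ σ≥0 _ → stay-legal σ≥0 }

  val : ∀ {τ} → IsAgility τ → ∃ λ v → v ≤ proj₁ diameter × IsValC[ τ ] v × IsValR[ τ ] v
  val {τ} τ≥0 = minimax stay wait (gameValue τ) (λ _ _ → value≥0)
      -- The initial distance to the first cop already bounds the value by the diameter bound.
      (λ q s v isValue → ≤-trans (value≤distance isValue 0 zero) (proj₂ diameter _ _)) guarantees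
    where
    open Minimax (IsValue τ)

    guarantees : ∀ a → ∃ (λ s → GuaranteesAtLeast s a) ⊎ ∃ (λ q → GuaranteesAtMost q a)
    guarantees a with Threshold.determined a τ≥0
    ... | inj₁ (s , far)  = inj₁ (s , λ q → ≤value (far q))
    ... | inj₂ (q , near) = inj₂ (q , λ s v isValue →
      let n , i , d<a = near s in ≤-trans (value≤distance isValue n i) (proj₁ d<a))

  Σ⁰⇒agility : ∀ {τ} → Σ⁰ τ → IsAgility τ
  Σ⁰⇒agility (τ>0 , _) n = proj₁ (τ>0 n)

  -- Suprema are unique, so `x` is the common value supplied by `val`.
  valC⇒valR : ∀ {τ x} → Σ⁰ τ → IsValC[ τ ] x → IsValR[ τ ] x
  valC⇒valR {τ} τ∈Σ⁰ isValC =
    let _ , _ , isValC′ , isValR = val (Σ⁰⇒agility τ∈Σ⁰)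
    in  subst IsValR[ τ ] (IsSup-unique isValC′ isValC) isValR

  valR⇒valC : ∀ {τ x} → Σ⁰ τ → IsValR[ τ ] x → IsValC[ τ ] x
  valR⇒valC {τ} τ∈Σ⁰ isValR =
    let _ , _ , isValC , isValR′ = val (Σ⁰⇒agility τ∈Σ⁰)
    in  subst IsValC[ τ ] (IsInf-unique isValR′ isValR) isValC

  ones∈Σ⁰ : Σ⁰ (λ _ → 1#)
  ones∈Σ⁰ = (λ _ → 0≤1 , 0≢1) , sum-of-ones-unbounded

  -- The two suprema range over the same set of reals, which contains the value for the constant
  -- agility 1 and is bounded by the diameter bound.
  overallVal : ∃ λ v → IsValC v × IsValR v
  overallVal =
    let v₁ , _ , isValC , _ = val (Σ⁰⇒agility ones∈Σ⁰)
        v , isSup = complete (λ x → ∃ λ τ → Σ⁰ τ × IsValC[ τ ] x)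
          (v₁ , _ , ones∈Σ⁰ , isValC)
          (proj₁ diameter , λ { x (τ , τ∈Σ⁰ , isValC) →
            let v′ , v′≤D , isValC′ , _ = val (Σ⁰⇒agility τ∈Σ⁰)
            in subst (_≤ proj₁ diameter) (IsSup-unique isValC′ isValC) v′≤D })
    in  v , isSup , IsSup-cong (λ { (τ , τ∈ , isC) → τ , τ∈ , valC⇒valR τ∈ isC })
                               (λ { (τ , τ∈ , isR) → τ , τ∈ , valR⇒valC τ∈ isR }) isSup

open import Data.Nat using (_≤_)

-- Each value relation has at most one solution, so a single `v` satisfying both expresses existence
-- and equality of the two values.
theorem12 :
    ExcludedMiddle 0ℓ →
    (R : CompleteOrderedField) (X : MetricSpace R) →
    MetricSpace.Carrier X → Compact X → Geodesic X →
    (k : ℕ) → 1 ≤ k →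
    let open CompleteOrderedField R using (ℝ)
        open Agilities R
        open Game X k
    in
    (∀ (τ : ℕ → ℝ) → Σ⁰ τ → Decreasing τ → ∃ λ v → IsValC[ τ ] v × IsValR[ τ ] v)
    × (∃ λ v → IsValC v × IsValR v)
theorem12 em R X x₀ compact _ (suc k) _ =
  (λ τ τ∈Σ⁰ _ → let v , _ , isValC , isValR = val (Σ⁰⇒agility τ∈Σ⁰) in v , isValC , isValR) , overallVal
  where open Values em X x₀ compact k
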